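{- Let $\mathcal{L}$ be a language and let $\mathfrak{A}=(A,\mathcal{F})$ be an $\mathcal{L}$-algebra. The following are equivalent. (1) $\mathfrak{A}$ is a Ramsey algebra. (2) For every $\vec{a}\in{}^{\omega}\!A$, the orderly $\mathcal{L}$-algebra $\mathfrak{A}_{\vec{a}}$ induced from $\mathfrak{A}$ by $\vec{a}$ is Ramsey. (3) For every $\vec{a}\in{}^{\omega}\!A$, the orderly $\mathcal{L}$-algebra $\mathfrak{A}_{\vec{a}}$ induced from $\mathfrak{A}$ by $\vec{a}$ is weakly Ramsey.
   Context: $\omega$ is the set of natural numbers (including $0$); ${}^{\omega}\!A$ is the set of infinite sequences in $A$. A language $\mathcal{L}$ is a set of function symbols, each of some arity $n\ge 1$ (no nullary symbols, no relation symbols). Fix variables $v_0,v_1,v_2,\dots$; the index of $v_i$ is $i$. Terms are built from variables and function symbols in the usual way and are written in prefix notation $ft_1\cdots t_n$. An $\mathcal{L}$-algebra $\mathfrak{A}=(A,\mathcal{F})$ is a nonempty set $A$ (its universe) with an interpretation $f^{\mathfrak{A}}:A^n\to A$ of each $n$-ary $f\in\mathcal{L}$, and $\mathcal{F}$ is the collection of these operations. For $\vec{a}\in{}^{\omega}\!A$, $t^{\mathfrak{A}}[\vec{a}]$ is the value of the term $t$ in $\mathfrak{A}$ when each $v_i$ is assigned $\vec{a}(i)$. For a collection $\mathcal{F}$ of operations on $A$, $\mathcal{L}_{\mathcal{F}}$ is the language with one symbol for each $f\in\mathcal{F}$, interpreted as $f$. An orderly term of $\mathcal{L}$ is a term in which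 the indices of the variables occurring, read from left to right, are strictly increasing; $\mathrm{OT}(\mathcal{L})$ is the set of orderly terms. For orderly terms, $t<t'$ means that the index of the last variable of $t$ is less than the index of the first variable of $t'$. $\mathrm{Adm}(\mathcal{L})$ is the set of infinite sequences $\vec{t}$ of orderly terms with $\vec{t}(0)<\vec{t}(1)<\vec{t}(2)<\cdots$. For $\vec{a},\vec{b}\in{}^{\omega}\!A$, $\vec{b}\leq_{\mathcal{F}}\vec{a}$ ("$\vec b$ is a reduction of $\vec a$") means there is $\vec{t}\in\mathrm{Adm}(\mathcal{L}_{\mathcal{F}})$ with $\vec{b}(i)=(\vec{t}(i))^{\mathfrak{A}}[\vec{a}]$ for all $i\in\omega$. $\mathrm{FR}_{\mathcal{F}}(\vec{a})=\{t^{\mathfrak{A}}[\vec{a}] : t\in\mathrm{OT}(\mathcal{L}_{\mathcal{F}})\}$. The algebra $(A,\mathcal{F})$ is Ramsey if for every $\vec{a}\in{}^{\omega}\!A$ and $X\subseteq A$ there is $\vec{b}\leq_{\mathcal{F}}\vec{a}$ such that $\mathrm{FR}_{\mathcal{F}}(\vec{b})$ is either contained in or disjoint from $X$. An orderly $\mathcal{L}$-algebra is a function $\mathscr{A}$ with domain $\mathrm{OT}(\mathcal{L})$ such that for each $n$-ary $f\in\mathcal{L}$: $\mathscr{A}(ft_1\cdots t_n)=\mathscr{A}(ft_1'\cdots t_n')$ whenever $t_1<\cdots<t_n$ and $t_1'<\cdots<t_n'$ are orderly terms with $\mathscr{A}(t_k)=\mathscr{A}(t_k')$ for $1\le k\le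 n$. Its universe $\Vert\mathscr{A}\Vert$ is its range. The orderly $\mathcal{L}$-algebra $\mathfrak{A}_{\vec{a}}$ induced from $\mathfrak{A}$ by $\vec{a}$ is defined by $\mathfrak{A}_{\vec{a}}(t)=t^{\mathfrak{A}}[\vec{a}]$ for all $t\in\mathrm{OT}(\mathcal{L})$. For $s\in\mathrm{OT}(\mathcal{L})$ and $\vec{t}\in\mathrm{Adm}(\mathcal{L})$, $s[\vec{t}]$ is the orderly term obtained by replacing each variable $v_i$ in $s$ by $\vec{t}(i)$. For orderly $\mathcal{L}$-algebras, $\mathscr{B}$ is a reduction of $\mathscr{A}$ if there is $\vec{t}\in\mathrm{Adm}(\mathcal{L})$ with $\mathscr{B}(s)=\mathscr{A}(s[\vec{t}])$ for all $s\in\mathrm{OT}(\mathcal{L})$. $\mathscr{B}$ is homogeneous for $X$ if $\Vert\mathscr{B}\Vert$ is either contained in or disjoint from $X$. $\mathscr{A}$ is weakly Ramsey if for every $X\subseteq\Vert\mathscr{A}\Vert$ there is a reduction of $\mathscr{A}$ homogeneous for $X$. $\mathscr{A}$ is Ramsey if for every reduction $\mathscr{B}$ of $\mathscr{A}$ and every $X\subseteq\Vert\mathscr{A}\Vert$ there is a reduction $\mathscr{C}$ of $\mathscr{B}$ homogeneous for $X$. -}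

module Defs where

open import Level using (Level) renaming (suc to lsuc)
open import Data.List.Base as List using (List; []; _∷_; _++_; [_]; concatMap)
open import Data.List.Properties using (++-identityʳ; concatMap-++)
open import Data.List.Relation.Unary.Linked as Linked using (Linked; []; [-]; _∷_)
import Data.List.Relation.Unary.Linked.Properties as Linkedₚ
open import Data.Fin.Base using (Fin; zero; suc)
open import Data.Maybe.Base using (Maybe; just)
open import Data.Maybe.Relation.Binary.Connected using (Connected; just)
open import Data.Nat.Base using (ℕ; zero; suc; _<_; _≤_; s≤s⁻¹)
open import Data.Nat.Properties using (≤-refl; ≤-trans; <⇒≤; ≤-<-trans; <-≤-trans; m≤n⇒m<n∨m≡n)
open import Data.Product.Base using (Σ; ∃; _×_; _,_; proj₁; proj₂)
open import Data.Sum.Base using (_⊎_; inj₁; inj₂)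
open import Data.Vec.Base as Vec using (Vec; []; _∷_)
import Data.Vec.Relation.Unary.Linked as VecLinked
open import Function.Base using (_∘_)
open import Relation.Binary.PropositionalEquality
  using (_≡_; refl; sym; trans; cong; cong₂; subst)
open import Relation.Unary using (Pred; _⊆_; _⊥_)

private
  variable
    ℓ : Level

------------------------------------------------------------------------
-- Languages, terms, algebras

-- Op n is the set of function symbols of arity suc n, so there are no
-- nullary symbols.
record Language (ℓ : Level) : Set (lsuc ℓ) where
  field
    Op : ℕ → Set ℓ

open Language public

data Term (L : Language ℓ) : Set ℓ where
  var : ℕ → Term L
  op  : ∀ {n} → Op L n → Vec (Term L) (suc n) → Term L

Interpretation : Language ℓ → Set ℓ → Set ℓ
Interpretation L A = ∀ {n} → Op L n → Vec A (suc n) → A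

record Algebra (L : Language ℓ) : Set (lsuc ℓ) where
  field
    Carrier  : Set ℓ
    nonempty : Carrier
    interp   : Interpretation L Carrier

open Algebra public

module _ {L : Language ℓ} {A : Set ℓ} (I : Interpretation L A) (a : ℕ → A) where

  mutual
    eval : Term L → A
    eval (var i)   = a i
    eval (op f ts) = I f (evals ts)

    evals : ∀ {n} → Vec (Term L) n → Vec A n
    evals []       = []
    evals (t ∷ ts) = eval t ∷ evals ts

------------------------------------------------------------------------
-- Orderly terms

module _ {L : Language ℓ} where

  mutual
    vars : Term L → List ℕ
    vars (var i)   = [ i ]
    vars (op f ts) = varss ts

    varss : ∀ {n} → Vec (Term L) n → List ℕ
    varss []       = []
    varss (t ∷ ts) = vars t ++ varss ts

  mutual
    firstVar : Term L → ℕ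
    firstVar (var i)         = i
    firstVar (op f (t ∷ ts)) = firstVar t

    lastVar : Term L → ℕ
    lastVar (var i)   = i
    lastVar (op f ts) = lastVars ts

    lastVars : ∀ {n} → Vec (Term L) (suc n) → ℕ
    lastVars (t ∷ [])     = lastVar t
    lastVars (t ∷ u ∷ us) = lastVars (u ∷ us)

  Orderly : Term L → Set
  Orderly t = Linked _<_ (vars t)

-- Orderly is proof-irrelevant, so an orderly term is determined by its term.
record OT (L : Language ℓ) : Set ℓ where
  constructor _,_
  field
    term    : Term L
    orderly : Orderly term

open OT public

infix 4 _≺_

_≺_ : {L : Language ℓ} → OT L → OT L → Set
t ≺ u = lastVar (term t) < firstVar (term u)

Adm : Language ℓ → Set ℓ
Adm L = Σ (ℕ → OT L) λ t → ∀ i → t i ≺ t (suc i)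

module _ {L : Language ℓ} where

  mutual
    head-vars : (t : Term L) → List.head (vars t) ≡ just (firstVar t)
    head-vars (var i)         = refl
    head-vars (op f (t ∷ ts)) = head-++ (vars t) (varss ts) (head-vars t)

    head-++ : ∀ (xs ys : List ℕ) {i} →
              List.head xs ≡ just i → List.head (xs ++ ys) ≡ just i
    head-++ (x ∷ xs) ys eq = eq

  last-++ : ∀ (xs ys : List ℕ) {i} →
            List.last ys ≡ just i → List.last (xs ++ ys) ≡ just i
  last-++ []            ys       eq = eq
  last-++ (x ∷ [])      (y ∷ ys) eq = eq
  last-++ (x ∷ x′ ∷ xs) ys       eq = last-++ (x′ ∷ xs) ys eq

  mutual
    last-vars : (t : Term L) → List.last (vars t) ≡ just (lastVar t)
    last-vars (var i)   = refl
    last-vars (op f ts) = last-varss ts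

    last-varss : ∀ {n} (ts : Vec (Term L) (suc n)) →
                 List.last (varss ts) ≡ just (lastVars ts)
    last-varss (t ∷ [])
      rewrite ++-identityʳ (vars t) = last-vars t
    last-varss (t ∷ u ∷ us)         =
      last-++ (vars t) (varss (u ∷ us)) (last-varss (u ∷ us))

  connected : ∀ {x y : Maybe ℕ} {i j} → x ≡ just i → y ≡ just j → i < j →
              Connected _<_ x y
  connected refl refl i<j = just i<j

  head≤last : ∀ (xs : List ℕ) {i j} → Linked _<_ xs →
              List.head xs ≡ just i → List.last xs ≡ just j → i ≤ j
  head≤last (x ∷ [])     [-]        refl refl = ≤-refl
  head≤last (x ∷ y ∷ xs) (x<y ∷ rs) refl q    =
    ≤-trans (<⇒≤ x<y) (head≤last (y ∷ xs) rs refl q)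

  firstVar≤lastVar : (t : OT L) → firstVar (term t) ≤ lastVar (term t)
  firstVar≤lastVar (t , o) = head≤last (vars t) o (head-vars t) (last-vars t)

  varss-linked : ∀ {n} {ts : Vec (OT L) n} → VecLinked.Linked _≺_ ts →
                 Linked _<_ (varss (Vec.map term ts))
  varss-linked VecLinked.[] = []
  varss-linked {ts = t ∷ []} VecLinked.[-] =
    subst (Linked _<_) (sym (++-identityʳ (vars (term t)))) (orderly t)
  varss-linked {ts = t ∷ u ∷ us} (t≺u VecLinked.∷ rs) =
    Linkedₚ.++⁺ (orderly t)
      (connected (last-vars (term t))
                 (head-++ (vars (term u)) _ (head-vars (term u))) t≺u)
      (varss-linked rs)

  Adm-mono : ((t , _) : Adm L) → ∀ {i j} → i < j → t i ≺ t j
  Adm-mono (t , t≺) {i} {suc j} i<1+j with m≤n⇒m<n∨m≡n (s≤s⁻¹ i<1+j)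
  ... | inj₁ i<j  = ≤-<-trans
    (<⇒≤ (<-≤-trans (Adm-mono (t , t≺) i<j) (firstVar≤lastVar (t j)))) (t≺ j)
  ... | inj₂ refl = t≺ i

  concatMap-linked : ((t , _) : Adm L) → ∀ {is} → Linked _<_ is →
                     Linked _<_ (concatMap (vars ∘ term ∘ t) is)
  concatMap-linked (t , t≺) []              = []
  concatMap-linked (t , t≺) ([-] {x = i})   =
    subst (Linked _<_) (sym (++-identityʳ (vars (term (t i))))) (orderly (t i))
  concatMap-linked (t , t≺) (_∷_ {x = i} {y = j} i<j rs) =
    Linkedₚ.++⁺ (orderly (t i))
      (connected (last-vars (term (t i)))
                 (head-++ (vars (term (t j))) _ (head-vars (term (t j))))
                 (Adm-mono (t , t≺) i<j))
      (concatMap-linked (t , t≺) rs)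

node : {L : Language ℓ} → ∀ {n} → Op L n →
       (ts : Vec (OT L) (suc n)) → VecLinked.Linked _≺_ ts → OT L
node f ts inc = op f (Vec.map term ts) , varss-linked inc

module _ {L : Language ℓ} (σ : ℕ → Term L) where

  mutual
    substitute : Term L → Term L
    substitute (var i)   = σ i
    substitute (op f ts) = op f (substitutes ts)

    substitutes : ∀ {n} → Vec (Term L) n → Vec (Term L) n
    substitutes []       = []
    substitutes (t ∷ ts) = substitute t ∷ substitutes ts

  mutual
    vars-substitute : ∀ s → vars (substitute s) ≡ concatMap (vars ∘ σ) (vars s)
    vars-substitute (var i)   = sym (++-identityʳ (vars (σ i)))
    vars-substitute (op f ts) = varss-substitutes ts

    varss-substitutes : ∀ {n} (ts : Vec (Term L) n) →
      varss (substitutes ts) ≡ concatMap (vars ∘ σ) (varss ts)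
    varss-substitutes []       = refl
    varss-substitutes (t ∷ ts) =
      trans (cong₂ _++_ (vars-substitute t) (varss-substitutes ts))
            (sym (concatMap-++ (vars ∘ σ) (vars t) (varss ts)))

_[_]ᵒ : {L : Language ℓ} → OT L → Adm L → OT L
(s , o) [ (t , t≺) ]ᵒ =
    substitute (term ∘ t) s
  , subst (Linked _<_) (sym (vars-substitute (term ∘ t) s))
      (concatMap-linked (t , t≺) o)

------------------------------------------------------------------------
-- Ramsey algebras (A , F)

Operations : Set ℓ → Set (lsuc ℓ)
Operations {ℓ} A = ∀ n → Pred (Vec A (suc n) → A) ℓ

-- The collection of fundamental operations of an algebra; functions are
-- identified when they agree pointwise.
operations : {L : Language ℓ} (𝔄 : Algebra L) → Operations (Carrier 𝔄)
operations {L = L} 𝔄 n g = Σ (Op L n) λ f → ∀ xs → interp 𝔄 f xs ≡ g xs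

-- The language whose symbols are the members of F, each interpreted as itself.
-- A symbol carries the evidence of membership in F, so no choice is needed to
-- pass from an operation of an algebra to a function symbol denoting it; the
-- same operation with different evidence gives symbols with the same meaning.
⟨_⟩ : {A : Set ℓ} → Operations A → Language ℓ
⟨ F ⟩ .Op n = ∃ (F n)

evalᶠ : {A : Set ℓ} (F : Operations A) → (ℕ → A) → OT ⟨ F ⟩ → A
evalᶠ F a t = eval {L = ⟨ F ⟩} proj₁ a (term t)

Reduction : {A : Set ℓ} (F : Operations A) → (b a : ℕ → A) → Set ℓ
Reduction F b a = Σ (Adm ⟨ F ⟩) λ (t , _) → ∀ i → b i ≡ evalᶠ F a (t i)

FR : {A : Set ℓ} (F : Operations A) → (ℕ → A) → Pred A ℓ
FR F a x = ∃ λ t → evalᶠ F a t ≡ x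

IsRamsey : {A : Set ℓ} → Operations A → Set (lsuc ℓ)
IsRamsey {ℓ} {A} F =
  ∀ (a : ℕ → A) (X : Pred A ℓ) →
  ∃ λ b → Reduction F b a × (FR F b ⊆ X ⊎ FR F b ⊥ X)

RamseyAlgebra : {L : Language ℓ} → Algebra L → Set (lsuc ℓ)
RamseyAlgebra 𝔄 = IsRamsey (operations 𝔄)

------------------------------------------------------------------------
-- Orderly algebras

-- U is only an ambient codomain; the universe is the range ‖_‖ below.
record OrderlyAlgebra (L : Language ℓ) (U : Set ℓ) : Set ℓ where
  field
    fun       : OT L → U
    congruent : ∀ {n} (f : Op L n) (ts us : Vec (OT L) (suc n))
                (ts-inc : VecLinked.Linked _≺_ ts)
                (us-inc : VecLinked.Linked _≺_ us) →
                (∀ k → fun (Vec.lookup ts k) ≡ fun (Vec.lookup us k)) →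
                fun (node f ts ts-inc) ≡ fun (node f us us-inc)

open OrderlyAlgebra public

module _ {L : Language ℓ} {U : Set ℓ} where

  ‖_‖ : OrderlyAlgebra L U → Pred U ℓ
  ‖ 𝒜 ‖ x = ∃ λ t → fun 𝒜 t ≡ x

  _IsReductionOf_ : (ℬ 𝒜 : OrderlyAlgebra L U) → Set ℓ
  ℬ IsReductionOf 𝒜 = Σ (Adm L) λ t → ∀ s → fun ℬ s ≡ fun 𝒜 (s [ t ]ᵒ)

  _HomogeneousFor_ : OrderlyAlgebra L U → Pred U ℓ → Set ℓ
  ℬ HomogeneousFor X = ‖ ℬ ‖ ⊆ X ⊎ ‖ ℬ ‖ ⊥ X

  WeaklyRamsey : OrderlyAlgebra L U → Set (lsuc ℓ)
  WeaklyRamsey 𝒜 =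
    ∀ (X : Pred U ℓ) → X ⊆ ‖ 𝒜 ‖ →
    ∃ λ ℬ → ℬ IsReductionOf 𝒜 × ℬ HomogeneousFor X

  Ramsey : OrderlyAlgebra L U → Set (lsuc ℓ)
  Ramsey 𝒜 =
    ∀ ℬ → ℬ IsReductionOf 𝒜 → ∀ (X : Pred U ℓ) → X ⊆ ‖ 𝒜 ‖ →
    ∃ λ 𝒞 → 𝒞 IsReductionOf ℬ × 𝒞 HomogeneousFor X

induced : {L : Language ℓ} (𝔄 : Algebra L) → (ℕ → Carrier 𝔄) →
          OrderlyAlgebra L (Carrier 𝔄)
induced {L = L} 𝔄 a = record
  { fun       = eval (interp 𝔄) a ∘ term
  ; congruent = λ f ts us _ _ eq → cong (interp 𝔄 f) (evals-cong ts us eq)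
  }
  where
  evals-cong : ∀ {n} (ts us : Vec (OT L) n) →
    (∀ (k : Fin n) → eval (interp 𝔄) a (term (Vec.lookup ts k)) ≡
                     eval (interp 𝔄) a (term (Vec.lookup us k))) →
    evals (interp 𝔄) a (Vec.map term ts) ≡ evals (interp 𝔄) a (Vec.map term us)
  evals-cong []       []       eq = refl
  evals-cong (t ∷ ts) (u ∷ us) eq =
    cong₂ _∷_ (eq zero) (evals-cong ts us (eq ∘ suc))

{-# OPTIONS --safe #-}

-- Translating symbols identifies orderly L-terms with orderly terms of the
-- language of the operations of 𝔄. By the substitution lemma, the reductions
-- of 𝔄_a are, up to pointwise equality, the 𝔄_b with b a reduction of a, and
-- the universe of 𝔄_b is FR b.
module Submission where

open import Level using (Level)
open import Data.Nat.Base using (ℕ; _<_)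
open import Data.Nat.Properties using (≤-refl)
open import Data.List.Base using (_++_)
open import Data.List.Relation.Unary.Linked using (Linked; [-])
open import Data.Product.Base using (∃; _×_; _,_; proj₁; proj₂)
open import Data.Sum.Base as Sum using (_⊎_)
open import Data.Vec.Base using (Vec; []; _∷_)
open import Function.Base using (_∘_)
open import Function.Bundles using (_⇔_; mk⇔)
open import Relation.Binary.PropositionalEquality
  using (_≡_; refl; sym; trans; cong; cong₂; subst; subst₂)
open import Relation.Unary using (Pred; _⊆_; _⊥_; _∩_)
open import Defs

private
  variable
    ℓ : Level

module _ {L : Language ℓ} {A : Set ℓ} (I : Interpretation L A)
         {a b : ℕ → A} {σ : ℕ → Term L} (b≡σ : ∀ i → b i ≡ eval I a (σ i)) where

  mutual
    -- The assumption on `b` is pointwise, since a reduction determines the entries of `b` only up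
    -- to propositional equality; this way function extensionality is never invoked.
    eval-substitute : ∀ s → eval I b s ≡ eval I a (substitute σ s)
    eval-substitute (var i)   = b≡σ i
    eval-substitute (op f ts) = cong (I f) (evals-substitutes ts)

    evals-substitutes : ∀ {n} (ts : Vec (Term L) n) →
                        evals I b ts ≡ evals I a (substitutes σ ts)
    evals-substitutes []       = refl
    evals-substitutes (t ∷ ts) =
      cong₂ _∷_ (eval-substitute t) (evals-substitutes ts)

-- Stated for any arity-preserving map of symbols so that it can be run in both directions. Renaming
-- symbols leaves the variables in place, so orderliness and admissibility carry over.
module Translate {L M : Language ℓ} (φ : ∀ {n} → Op L n → Op M n) where

  mutual
    translate : Term L → Term M
    translate (var i)   = var i
    translate (op f ts) = op (φ f) (translates ts)

    translates : ∀ {n} → Vec (Term L) n → Vec (Term M) n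
    translates []       = []
    translates (t ∷ ts) = translate t ∷ translates ts

  mutual
    vars-translate : ∀ t → vars (translate t) ≡ vars t
    vars-translate (var i)   = refl
    vars-translate (op f ts) = varss-translates ts

    varss-translates : ∀ {n} (ts : Vec (Term L) n) →
                       varss (translates ts) ≡ varss ts
    varss-translates []       = refl
    varss-translates (t ∷ ts) =
      cong₂ _++_ (vars-translate t) (varss-translates ts)

  firstVar-translate : ∀ t → firstVar (translate t) ≡ firstVar t
  firstVar-translate (var i)         = refl
  firstVar-translate (op f (t ∷ ts)) = firstVar-translate t

  mutual
    lastVar-translate : ∀ t → lastVar (translate t) ≡ lastVar t
    lastVar-translate (var i)   = refl
    lastVar-translate (op f ts) = lastVars-translates ts

    lastVars-translates : ∀ {n} (ts : Vec (Term L) (ℕ.suc n)) →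
                          lastVars (translates ts) ≡ lastVars ts
    lastVars-translates (t ∷ [])     = lastVar-translate t
    lastVars-translates (t ∷ u ∷ us) = lastVars-translates (u ∷ us)

  translateᵒ : OT L → OT M
  translateᵒ (t , o) =
    translate t , subst (Linked _<_) (sym (vars-translate t)) o

  translateᵃ : Adm L → Adm M
  translateᵃ (t , t≺) = translateᵒ ∘ t , λ i →
    subst₂ _<_ (sym (lastVar-translate (term (t i))))
               (sym (firstVar-translate (term (t (ℕ.suc i))))) (t≺ i)

  module _ {A : Set ℓ} {I : Interpretation L A} {J : Interpretation M A}
           (I≡J : ∀ {n} (f : Op L n) xs → I f xs ≡ J (φ f) xs)
           (a : ℕ → A) where

    mutual
      -- `I≡J` is pointwise because a symbol of `⟨ F ⟩` is a function agreeing only pointwise with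
      -- the fundamental operation that witnesses its membership.
      eval-translate : ∀ t → eval I a t ≡ eval J a (translate t)
      eval-translate (var i)   = refl
      eval-translate (op f ts) =
        trans (I≡J f (evals I a ts)) (cong (J (φ f)) (evals-translates ts))

      evals-translates : ∀ {n} (ts : Vec (Term L) n) →
                         evals I a ts ≡ evals J a (translates ts)
      evals-translates []       = refl
      evals-translates (t ∷ ts) =
        cong₂ _∷_ (eval-translate t) (evals-translates ts)

varᵃ : (L : Language ℓ) → Adm L
varᵃ L = (λ i → var i , [-]) , λ i → ≤-refl

module _ {U : Set ℓ} {P Q X : Pred U ℓ} where

  homogeneous-⊆ : P ⊆ Q → Q ⊆ X ⊎ Q ⊥ X → P ⊆ X ⊎ P ⊥ X
  homogeneous-⊆ P⊆Q = Sum.map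
    (λ Q⊆X → Q⊆X ∘ P⊆Q) (λ Q⊥X (p , x) → Q⊥X (P⊆Q p , x))

  -- Weak Ramseyness accepts only subsets of the universe `Q`, so `X` must be cut down to `X ∩ Q`.
  -- Inside `P` the cut removes nothing.
  homogeneous-∩ : P ⊆ Q → P ⊆ (X ∩ Q) ⊎ P ⊥ (X ∩ Q) → P ⊆ X ⊎ P ⊥ X
  homogeneous-∩ P⊆Q = Sum.map
    (λ P⊆X∩Q → proj₁ ∘ P⊆X∩Q) (λ P⊥X∩Q (p , x) → P⊥X∩Q (p , x , P⊆Q p))

-- The variables in their order form an admissible sequence, and the substitution lemma with `b`
-- equal to `a` shows that substituting them preserves values.
isReductionOf-refl : {L : Language ℓ} (𝔄 : Algebra L) (a : ℕ → Carrier 𝔄) →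
                     induced 𝔄 a IsReductionOf induced 𝔄 a
isReductionOf-refl {L = L} 𝔄 a =
  varᵃ L , λ s → eval-substitute (interp 𝔄) (λ i → refl) (term s)

reduction-‖‖ : {L : Language ℓ} {U : Set ℓ} {ℬ 𝒜 : OrderlyAlgebra L U} →
               ℬ IsReductionOf 𝒜 → ‖ ℬ ‖ ⊆ ‖ 𝒜 ‖
reduction-‖‖ (t , ℬ≡) (s , eq) = s [ t ]ᵒ , trans (sym (ℬ≡ s)) eq

module _ {L : Language ℓ} (𝔄 : Algebra L) where

  private
    A = Carrier 𝔄
    I = interp 𝔄
    F = operations 𝔄

    -- `To` sends a symbol to its own interpretation, with that symbol as evidence; `From` reads the
    -- symbol back from the evidence, so no choice is made.
    module To   = Translate {L = L} {M = ⟨ F ⟩} (λ f → I f , f , λ _ → refl)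
    module From = Translate {L = ⟨ F ⟩} {M = L} (λ (_ , f , _) → f)

  evalᶠ-to : ∀ a (t : OT L) → eval I a (term t) ≡ evalᶠ F a (To.translateᵒ t)
  evalᶠ-to a t = To.eval-translate {J = proj₁} (λ _ _ → refl) a (term t)

  evalᶠ-from : ∀ a (t : OT ⟨ F ⟩) →
               evalᶠ F a t ≡ eval I a (term (From.translateᵒ t))
  evalᶠ-from a t =
    From.eval-translate {I = proj₁} (λ (_ , _ , f≡g) xs → sym (f≡g xs)) a (term t)

  ‖induced‖⊆FR : ∀ a → ‖ induced 𝔄 a ‖ ⊆ FR F a
  ‖induced‖⊆FR a (t , eq) = To.translateᵒ t , trans (sym (evalᶠ-to a t)) eq

  FR⊆‖induced‖ : ∀ a → FR F a ⊆ ‖ induced 𝔄 a ‖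
  FR⊆‖induced‖ a (t , eq) = From.translateᵒ t , trans (sym (evalᶠ-from a t)) eq

  reduction⇒induced : ∀ {a b} → Reduction F b a →
                      induced 𝔄 b IsReductionOf induced 𝔄 a
  reduction⇒induced {a} (t , b≡) = From.translateᵃ t , λ s →
    eval-substitute I (λ i → trans (b≡ i) (evalᶠ-from a (proj₁ t i))) (term s)

  -- If `t` witnesses the reduction, `b` lists the values of its terms at `a`; evaluating `s` at `b`
  -- is then evaluating `s [ t ]ᵒ` at `a`.
  isReductionOf-induced : ∀ {a} ℬ → ℬ IsReductionOf induced 𝔄 a →
    ∃ λ b → Reduction F b a × (∀ s → fun ℬ s ≡ fun (induced 𝔄 b) s)
  isReductionOf-induced {a} ℬ (t , ℬ≡) =
      (λ i → eval I a (term (proj₁ t i)))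
    , (To.translateᵃ t , λ i → evalᶠ-to a (proj₁ t i))
    , λ s → trans (ℬ≡ s) (sym (eval-substitute I (λ i → refl) (term s)))

  ramseyAlgebra⇒ramsey : RamseyAlgebra 𝔄 → ∀ a → Ramsey (induced 𝔄 a)
  ramseyAlgebra⇒ramsey R a ℬ ℬ≤𝔄a X _
    with b , _ , ℬ≡     ← isReductionOf-induced ℬ ℬ≤𝔄a
    -- Homogeneity is sought below `b`, not `a`, because `ℬ` is pointwise the algebra induced by
    -- `b`; the terms that reduce `b` to `c` then also reduce `ℬ`.
    with c , c≤b , hom  ← R b X
    with t , 𝔄c≡        ← reduction⇒induced c≤b
    = induced 𝔄 c
    , (t , λ s → trans (𝔄c≡ s) (sym (ℬ≡ (s [ t ]ᵒ))))
    , homogeneous-⊆ (‖induced‖⊆FR c) hom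

  ramsey⇒weaklyRamsey : ∀ a → Ramsey (induced 𝔄 a) → WeaklyRamsey (induced 𝔄 a)
  ramsey⇒weaklyRamsey a R = R (induced 𝔄 a) (isReductionOf-refl 𝔄 a)

  weaklyRamsey⇒ramseyAlgebra : (∀ a → WeaklyRamsey (induced 𝔄 a)) →
                               RamseyAlgebra 𝔄
  weaklyRamsey⇒ramseyAlgebra W a X
    with ℬ , ℬ≤𝔄a , hom ← W a (X ∩ ‖ induced 𝔄 a ‖) proj₂
    with b , b≤a , ℬ≡   ← isReductionOf-induced ℬ ℬ≤𝔄a
    = b , b≤a , homogeneous-⊆ FR⊆‖ℬ‖
        (homogeneous-∩ (reduction-‖‖ {ℬ = ℬ} {𝒜 = induced 𝔄 a} ℬ≤𝔄a) hom)
    where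
    FR⊆‖ℬ‖ : FR F b ⊆ ‖ ℬ ‖
    -- `ℬ` agrees with the algebra induced by `b`, so its homogeneity passes to `FR F b`.
    FR⊆‖ℬ‖ x∈FR with s , eq ← FR⊆‖induced‖ b x∈FR = s , trans (ℬ≡ s) eq

theorem4p4 : {ℓ : Level} (L : Language ℓ) (𝔄 : Algebra L) →
    (RamseyAlgebra 𝔄 ⇔ (∀ (a : ℕ → Carrier 𝔄) → Ramsey (induced 𝔄 a))) ×
    ((∀ (a : ℕ → Carrier 𝔄) → Ramsey (induced 𝔄 a)) ⇔
    (∀ (a : ℕ → Carrier 𝔄) → WeaklyRamsey (induced 𝔄 a)))
theorem4p4 L 𝔄 =
    mk⇔ (ramseyAlgebra⇒ramsey 𝔄)
        (λ R → weaklyRamsey⇒ramseyAlgebra 𝔄 (λ a → ramsey⇒weaklyRamsey 𝔄 a (R a)))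
  , mk⇔ (λ R a → ramsey⇒weaklyRamsey 𝔄 a (R a))
        (λ W → ramseyAlgebra⇒ramsey 𝔄 (weaklyRamsey⇒ramseyAlgebra 𝔄 W))
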